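{- Let $G=(V,E)$ be a path graph and let $T$ be any transaction matrix on $V$. Then there is a fee assignment $f_E$ with $f_e\in\{0,1\}$ for every $e\in E$ such that $p(G,T,f_E)\ge p(G,T,f'_E)$ for every fee assignment $f'_E\in[0,1]^E$. That is, the optimal profit on a given path can always be achieved by assigning to each edge a fee of $0$ or $1$.
   Context: A transaction matrix on a vertex set $V$ with $|V|=n$ is a symmetric matrix $T\in\mathbb{N}^{n\times n}$ ($0\in\mathbb{N}$) with zero diagonal; $T[i,j]$ is the number of transactions between $i$ and $j$ (in either direction). A payment network is a finite undirected graph $G=(V,E)$ with $m=|E|$. A fee assignment $f_E$ gives each edge $e\in E$ a real fee $f_e$ with $0\le f_e\le 1$ (the value $1$ is the cost of a transaction on the blockchain). For $i,j\in V$, $path(i,j)$ denotes the edge set of a cheapest path from $i$ to $j$ in $G$, i.e., one minimizing the sum of the fees of its edges (in a path graph this is the unique path from $i$ to $j$). The profit is $$p(G,T,f_E)=-m+\sum_{i,j\in V}\ \sum_{e\in path(i,j)} f_e\cdot X_{ij}\cdot T[i,j],$$ where $X_{ij}=1$ if $\sum_{e\in path(i,j)}f_e\le 1$ and $X_{ij}=0$ otherwise. (It is not required that all transactions use the network.) -}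

module Defs where

open import Algebra.Bundles using (RawMonoid)
import Algebra.Definitions.RawMonoid as RawMonoidDefs
open import Axiom.ExcludedMiddle using (ExcludedMiddle)
open import Data.Bool.Base using (if_then_else_)
open import Data.Fin.Base using (Fin; inject₁) renaming (suc to fsuc)
open import Data.Integer.Base as ℤ using ()
open import Data.List.Base using (List; []; _∷_; map; foldr)
open import Data.List.Relation.Unary.Unique.Propositional using (Unique)
open import Data.Nat.Base as ℕ using (ℕ; suc)
import Data.Nat.Properties as ℕₚ
open import Data.Product.Base using (Σ-syntax; ∃-syntax; _×_; _,_; proj₁; proj₂)
open import Data.Rational.Base as ℚ using (ℚ; 0ℚ; 1ℚ; ½)
import Data.Rational.Properties as ℚₚ
open import Data.Rational.Solver using (module +-*-Solver)
open import Data.Sum.Base using (_⊎_)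
open import Function.Bundles using (_↔_; module Inverse)
open import Level using (0ℓ)
open import Relation.Binary.PropositionalEquality
open import Relation.Nullary.Decidable.Core using (Dec; yes; no; does)
open import Relation.Nullary.Negation.Core using (¬_)

------------------------------------------------------------------------
-- Real numbers: Cauchy sequences of rationals, with setoid equality _≈_

IsCauchy : (ℕ → ℚ) → Set
IsCauchy x = ∀ ε → 0ℚ ℚ.< ε →
  ∃[ N ] (∀ i j → N ℕ.≤ i → N ℕ.≤ j → ℚ.∣ x i ℚ.- x j ∣ ℚ.< ε)

record ℝ : Set where
  constructor mkℝ
  field
    seq    : ℕ → ℚ
    cauchy : IsCauchy seq

open ℝ public

fromℚ : ℚ → ℝ
fromℚ q = mkℝ (λ _ → q) λ ε 0<ε →
  0 , λ _ _ _ _ → subst (ℚ._< ε) (cong ℚ.∣_∣ (sym (ℚₚ.+-inverseʳ q))) 0<ε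

0ℝ 1ℝ : ℝ
0ℝ = fromℚ 0ℚ
1ℝ = fromℚ 1ℚ

infixl 6 _+_
_+_ : ℝ → ℝ → ℝ
x + y = mkℝ (λ n → seq x n ℚ.+ seq y n) cau
  where
  interchange : ∀ a b c d → (a ℚ.+ b) ℚ.- (c ℚ.+ d) ≡ (a ℚ.- c) ℚ.+ (b ℚ.- d)
  interchange = solve 4 (λ a b c d → (a :+ b) :- (c :+ d) := (a :- c) :+ (b :- d)) refl
    where open +-*-Solver

  halves : ∀ ε → ½ ℚ.* ε ℚ.+ ½ ℚ.* ε ≡ ε
  halves ε = trans (sym (ℚₚ.*-distribʳ-+ ε ½ ½)) (ℚₚ.*-identityˡ ε)

  cau : IsCauchy (λ n → seq x n ℚ.+ seq y n)
  cau ε 0<ε = Nx ℕ.⊔ Ny , bound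
    where
    ε/2 = ½ ℚ.* ε
    0<ε/2 : 0ℚ ℚ.< ε/2
    0<ε/2 = subst (ℚ._< ε/2) (ℚₚ.*-zeroʳ ½) (ℚₚ.*-monoʳ-<-pos ½ 0<ε)
    cx = cauchy x ε/2 0<ε/2
    cy = cauchy y ε/2 0<ε/2
    Nx = proj₁ cx
    Ny = proj₁ cy
    bound : ∀ i j → Nx ℕ.⊔ Ny ℕ.≤ i → Nx ℕ.⊔ Ny ℕ.≤ j →
            ℚ.∣ (seq x i ℚ.+ seq y i) ℚ.- (seq x j ℚ.+ seq y j) ∣ ℚ.< ε
    bound i j N≤i N≤j = begin-strict
      ℚ.∣ (seq x i ℚ.+ seq y i) ℚ.- (seq x j ℚ.+ seq y j) ∣
        ≡⟨ cong ℚ.∣_∣ (interchange (seq x i) (seq y i) (seq x j) (seq y j)) ⟩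
      ℚ.∣ dx ℚ.+ dy ∣
        ≤⟨ ℚₚ.∣p+q∣≤∣p∣+∣q∣ dx dy ⟩
      ℚ.∣ dx ∣ ℚ.+ ℚ.∣ dy ∣
        <⟨ ℚₚ.+-mono-<
             (proj₂ cx i j (ℕₚ.m⊔n≤o⇒m≤o Nx Ny N≤i) (ℕₚ.m⊔n≤o⇒m≤o Nx Ny N≤j))
             (proj₂ cy i j (ℕₚ.m⊔n≤o⇒n≤o Nx Ny N≤i) (ℕₚ.m⊔n≤o⇒n≤o Nx Ny N≤j)) ⟩
      ε/2 ℚ.+ ε/2
        ≡⟨ halves ε ⟩
      ε ∎
      where
      open ℚₚ.≤-Reasoning
      dx = seq x i ℚ.- seq x j
      dy = seq y i ℚ.- seq y j

-- "Up to every ε, eventually": a termwise comparison would not respect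
-- equality of limits.
infix 4 _≤_ _≈_
_≤_ : ℝ → ℝ → Set
x ≤ y = ∀ ε → 0ℚ ℚ.< ε → ∃[ N ] (∀ i → N ℕ.≤ i → seq x i ℚ.≤ seq y i ℚ.+ ε)

_≈_ : ℝ → ℝ → Set
x ≈ y = x ≤ y × y ≤ x

+-0-rawMonoid : RawMonoid 0ℓ 0ℓ
+-0-rawMonoid = record { Carrier = ℝ ; _≈_ = _≈_ ; _∙_ = _+_ ; ε = 0ℝ }

-- k · x is the product of the natural number k with the real x, as an
-- iterated sum; no other multiplication is needed for the profit.
open RawMonoidDefs +-0-rawMonoid public using (sum) renaming (_×_ to _·_)

sumList : List ℝ → ℝ
sumList = foldr _+_ 0ℝ

------------------------------------------------------------------------
-- Graphs

-- Finite simple undirected graphs, with vertices Fin n and edges Fin m.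
-- The order in which `ends` lists the endpoints of an edge is irrelevant:
-- everything below goes through the symmetric relation Joins.
record Graph : Set where
  field
    n m  : ℕ
    ends : Fin m → Fin n × Fin n

  Joins : Fin m → Fin n → Fin n → Set
  Joins e u v = ends e ≡ (u , v) ⊎ ends e ≡ (v , u)

  field
    loopless   : ∀ e v → ¬ Joins e v v
    noParallel : ∀ e e′ u v → Joins e u v → Joins e′ u v → e ≡ e′

module _ (G : Graph) where
  open Graph G

  data Walk : Fin n → Fin n → Set where
    stop : ∀ {v} → Walk v v
    step : ∀ {u v w} (e : Fin m) → Joins e u v → Walk v w → Walk u w

  -- The path v₀ –e₀– v₁ –e₁– ⋯ –eₘ₋₁– vₘ, for arbitrary enumerations of
  -- the vertices and of the edges.
  record IsPathGraph : Set where
    field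
      vertex : Fin (suc m) ↔ Fin n
      edge   : Fin m ↔ Fin m
      joins  : ∀ k → Joins (Inverse.to edge k)
                           (Inverse.to vertex (inject₁ k))
                           (Inverse.to vertex (fsuc k))

module _ {G : Graph} where
  open Graph G

  vertices : ∀ {u v} → Walk G u v → List (Fin n)
  vertices (stop {v})         = v ∷ []
  vertices (step {u = u} _ _ w) = u ∷ vertices w

  edges : ∀ {u v} → Walk G u v → List (Fin m)
  edges stop         = []
  edges (step e _ w) = e ∷ edges w

record Path (G : Graph) (u v : Fin (Graph.n G)) : Set where
  field
    walk   : Walk G u v
    simple : Unique (vertices walk)

pathEdges : ∀ {G u v} → Path G u v → List (Fin (Graph.m G))
pathEdges p = edges (Path.walk p)

------------------------------------------------------------------------
-- Payment networks

record TransactionMatrix (n : ℕ) : Set where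
  field
    T         : Fin n → Fin n → ℕ
    symmetric : ∀ i j → T i j ≡ T j i
    zeroDiag  : ∀ i → T i i ≡ 0

record FeeAssignment (G : Graph) : Set where
  field
    fee   : Fin (Graph.m G) → ℝ
    0≤fee : ∀ e → 0ℝ ≤ fee e
    fee≤1 : ∀ e → fee e ≤ 1ℝ

IsZeroOne : ∀ {G} → FeeAssignment G → Set
IsZeroOne f = ∀ e → (FeeAssignment.fee f e ≈ 0ℝ) ⊎ (FeeAssignment.fee f e ≈ 1ℝ)

module _ {G : Graph} (f : FeeAssignment G) where
  open Graph G
  open FeeAssignment f

  cost : ∀ {i j} → Path G i j → ℝ
  cost p = sumList (map fee (pathEdges p))

  CheapestPath : Fin n → Fin n → Set
  CheapestPath i j = Σ[ p ∈ Path G i j ] (∀ (q : Path G i j) → cost p ≤ cost q)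

-- Comparison of reals is not decidable constructively, so the 0/1-valued
-- X is defined relative to excluded middle.  Excluded middle also selects
-- the cheapest path; the `no` case below is that of two vertices in
-- different components of G, whose transactions cannot use the network.
module _ (em : ExcludedMiddle 0ℓ) (G : Graph)
         (𝐓 : TransactionMatrix (Graph.n G)) (f : FeeAssignment G) where
  open Graph G
  open TransactionMatrix 𝐓
  open FeeAssignment f

  X : ∀ {i j} → Path G i j → ℕ
  X p = if does (em {cost f p ≤ 1ℝ}) then 1 else 0

  income : ∀ i j → Dec (CheapestPath f i j) → ℝ
  income i j (yes (p , _)) = sumList (map (λ e → (X p ℕ.* T i j) · fee e) (pathEdges p))
  income i j (no _)        = 0ℝ

  profit : ℝ
  profit = fromℚ ((ℤ.- (ℤ.+ m)) ℚ./ 1) + sum (λ i → sum (λ j → income i j em))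

{-# OPTIONS --safe #-}
module Submission where

-- Let F be the prefix sums of a fee assignment f along the path.  For a shift
-- θ ∈ [0,1) let g^θ give the edge from k to k+1 the fee ⌊F(k+1)+θ⌋ − ⌊F(k)+θ⌋.
-- This is 0 or 1, its sum over a subpath on which f costs at most 1 is again
-- at most 1, and f is the average of g^θ over θ.  The income from the pairs
-- served by f is linear in the fees, so some g^θ earns at least as much.
--
-- Real fees are first replaced by naturals a ≈ D·f, where subpaths of cost at
-- most 1 get sums at most C = D + O(m).  The shifts then range over θ < C, the
-- floors are integer quotients by C, and averaging becomes Hermite's identity
-- Σ_{θ<C} ⌊(x+θ)/C⌋ = x.  The error factor C/D tends to 1.

open import Defs
open import Algebra.Bundles using (RawMonoid; module CommutativeMonoid; module CommutativeRing)
import Algebra.Definitions.RawMonoid as RawMonoidDefs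
import Algebra.Properties.CommutativeMonoid.Mult as CommutativeMonoidMult
import Algebra.Properties.CommutativeMonoid.Sum as CommutativeMonoidSum
import Algebra.Properties.CommutativeSemigroup as CommutativeSemigroupProperties
import Algebra.Properties.Semiring.Mult as SemiringMult
open import Axiom.ExcludedMiddle using (ExcludedMiddle)
open import Data.Bool.Base using (if_then_else_)
open import Data.Empty using (⊥-elim)
open import Data.Fin.Base using (Fin; toℕ; fromℕ<; inject₁) renaming (zero to fzero; suc to fsuc)
import Data.Fin.Properties as Finₚ
open import Data.Integer.Base as ℤ using (+_; -[1+_])
import Data.Integer.Properties as ℤₚ
open import Data.List.Base using (List; []; _∷_; map; foldr; iterate; length)
open import Data.List.Properties using (map-injective; ∷-injectiveˡ; ∷-injectiveʳ)
open import Data.List.Relation.Unary.All as All using (All; []; _∷_)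
open import Data.List.Relation.Unary.AllPairs using (_∷_)
open import Data.List.Relation.Unary.Unique.Propositional using (Unique)
open import Data.Nat.Base as ℕ using (ℕ; zero; suc; pred)
import Data.Nat.Coprimality as Coprimality
open import Data.Nat.Divisibility using (∣-refl)
import Data.Nat.DivMod as DivMod
import Data.Nat.Properties as ℕₚ
open import Data.Nat.Solver using (module +-*-Solver)
open import Data.Product.Base using (Σ-syntax; ∃-syntax; _×_; _,_; proj₁; proj₂)
open import Data.Rational.Base as ℚ using (ℚ; mkℚ; 0ℚ; 1ℚ; *≤*)
import Data.Rational.Properties as ℚₚ
open import Data.Sum.Base using (_⊎_; inj₁; inj₂)
open import Data.Vec.Base as Vec using (Vec; []; _∷_)
open import Data.Vec.Properties using (lookup∘tabulate)
open import Function.Base using (_∘_)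
open import Function.Bundles using (module Inverse)
open import Level using (0ℓ)
open import Relation.Binary.PropositionalEquality
open import Relation.Nullary.Decidable.Core using (Dec; yes; no; does)

module ∑ℕ = CommutativeMonoidSum ℕₚ.+-0-commutativeMonoid
module ×ℚ = CommutativeMonoidMult ℚₚ.+-0-commutativeMonoid
open RawMonoidDefs ℕ.+-0-rawMonoid using () renaming (_×_ to _×ℕ_)
open ×ℚ using () renaming (_×_ to _×ℚ_)

listSum : (M : RawMonoid 0ℓ 0ℓ) {A : Set} → (A → RawMonoid.Carrier M) → List A → RawMonoid.Carrier M
listSum M a es = foldr _∙_ ε (map a es)
  where open RawMonoid M

sumℕ : {A : Set} → (A → ℕ) → List A → ℕ
sumℕ = listSum ℕ.+-0-rawMonoid

-- Simple paths in a path graph as intervals of positions.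

module PathGraph (G : Graph) (isPath : IsPathGraph G) where
  open Graph G
  open IsPathGraph isPath

  position : Fin n → ℕ
  position = toℕ ∘ Inverse.from vertex

  edgePosition : Fin m → ℕ
  edgePosition = toℕ ∘ Inverse.from edge

  to-from : ∀ e → Inverse.to edge (Inverse.from edge e) ≡ e
  to-from e = Inverse.inverseˡ edge refl

  position-injective : ∀ {u v} → position u ≡ position v → u ≡ v
  position-injective {u} {v} eq =
    trans (sym (Inverse.inverseˡ vertex refl))
      (trans (cong (Inverse.to vertex) (Finₚ.toℕ-injective eq)) (Inverse.inverseˡ vertex refl))

  edgePosition-injective : ∀ {e e′} → edgePosition e ≡ edgePosition e′ → e ≡ e′
  edgePosition-injective {e} {e′} eq =
    trans (sym (to-from e)) (trans (cong (Inverse.to edge) (Finₚ.toℕ-injective eq)) (to-from e′))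

  Ascends Descends : Fin m → Fin n → Fin n → Set
  Ascends e u v = position u ≡ edgePosition e × position v ≡ suc (edgePosition e)
  Descends e u v = Ascends e v u

  ends-ascend : ∀ e → ∃[ x ] ∃[ y ] (Joins e x y × Ascends e x y)
  ends-ascend e =
    x , y , subst (λ e′ → Joins e′ x y) (to-from e) (joins k) ,
    trans (cong toℕ (Inverse.inverseʳ vertex refl)) (Finₚ.toℕ-inject₁ k) ,
    cong toℕ (Inverse.inverseʳ vertex refl)
    where
    k = Inverse.from edge e
    x = Inverse.to vertex (inject₁ k)
    y = Inverse.to vertex (fsuc k)

  joins-direction : ∀ {e u v} → Joins e u v → Ascends e u v ⊎ Descends e u v
  joins-direction {e} j with ends-ascend e
  joins-direction (inj₁ p) | _ , _ , inj₁ q , a with refl ← trans (sym p) q = inj₁ a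
  joins-direction (inj₁ p) | _ , _ , inj₂ q , a with refl ← trans (sym p) q = inj₂ a
  joins-direction (inj₂ p) | _ , _ , inj₁ q , a with refl ← trans (sym p) q = inj₂ a
  joins-direction (inj₂ p) | _ , _ , inj₂ q , a with refl ← trans (sym p) q = inj₁ a

  -- The edge at position `k` joins the vertices at `k` and `suc k`, so a falling walk begins with
  -- the edge one below its source. At position 0 it is empty, and the truncated `pred` is never
  -- read.
  Rising Falling : Fin n → Fin n → List (Fin m) → Set
  Rising u v es = ∃[ k ] (map edgePosition es ≡ iterate suc (position u) k ×
                          k ℕ.+ position u ≡ position v)
  Falling u v es = ∃[ k ] (map edgePosition es ≡ iterate pred (pred (position u)) k ×
                           k ℕ.+ position v ≡ position u)

  rising-step : ∀ {e u v z es} → Ascends e u v → Rising v z es → Rising u z (e ∷ es)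
  rising-step {u = u} {v} (pu , pv) (k , eqs , eq) =
    suc k ,
    cong₂ _∷_ (sym pu) (trans eqs (cong (λ p → iterate suc p k) pv≡1+pu)) ,
    trans (sym (ℕₚ.+-suc k _)) (trans (cong (k ℕ.+_) (sym pv≡1+pu)) eq)
    where
    pv≡1+pu : position v ≡ suc (position u)
    pv≡1+pu = trans pv (cong suc (sym pu))

  falling-step : ∀ {e u v z es} → Descends e u v → Falling v z es → Falling u z (e ∷ es)
  falling-step (pv , pu) (k , eqs , eq) =
    suc k ,
    cong₂ _∷_ (cong pred (sym pu))
      (trans eqs (cong (λ p → iterate pred (pred p) k) (trans pv (cong pred (sym pu))))) ,
    trans (cong suc (trans eq pv)) (sym pu)

  -- Positions are injective, so the vertex just left is the only one directly below `v`, and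
  -- simplicity forbids a return to it.
  no-vertex-below : ∀ {e u v xs} → Ascends e u v → All (u ≢_) xs →
                    All (λ x → suc (position x) ≢ position v) xs
  no-vertex-below (pu , pv) = All.map λ u≢x eq →
    u≢x (position-injective (trans pu (ℕₚ.suc-injective (trans (sym pv) (sym eq)))))

  no-vertex-above : ∀ {e u v xs} → Descends e u v → All (u ≢_) xs →
                    All (λ x → position x ≢ suc (position v)) xs
  no-vertex-above (pv , pu) = All.map λ u≢x eq →
    u≢x (position-injective (trans pu (trans (cong suc (sym pv)) (sym eq))))

  all-source : ∀ {u v} {P : Fin n → Set} (w : Walk G u v) → All P (vertices w) → P u
  all-source stop         (p ∷ _) = p
  all-source (step _ _ _) (p ∷ _) = p

  -- A descending first step would end directly below `u`, which the hypothesis excludes; each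
  -- ascending step restores the hypothesis for the tail.
  rising : ∀ {u v} (w : Walk G u v) → Unique (vertices w) →
           All (λ x → suc (position x) ≢ position u) (vertices w) → Rising u v (edges w)
  rising stop _ _ = 0 , refl , refl
  rising (step e j w) (u∉w ∷ uniq) (_ ∷ above) with joins-direction j
  ... | inj₁ asc       = rising-step asc (rising w uniq (no-vertex-below asc u∉w))
  ... | inj₂ (pv , pu) = ⊥-elim (all-source w above (trans (cong suc pv) (sym pu)))

  falling : ∀ {u v} (w : Walk G u v) → Unique (vertices w) →
            All (λ x → position x ≢ suc (position u)) (vertices w) → Falling u v (edges w)
  falling stop _ _ = 0 , refl , refl
  falling (step e j w) (u∉w ∷ uniq) (_ ∷ below) with joins-direction j
  ... | inj₁ (pu , pv) = ⊥-elim (all-source w below (trans pv (cong suc (sym pu))))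
  ... | inj₂ desc      = falling-step desc (falling w uniq (no-vertex-above desc u∉w))

  -- A simple walk cannot turn back, so its first step fixes its direction.
  monotone : ∀ {u v} (p : Path G u v) →
             Rising u v (pathEdges p) ⊎ Falling u v (pathEdges p)
  monotone record { walk = stop } = inj₁ (0 , refl , refl)
  monotone record { walk = step e j w ; simple = u∉w ∷ uniq } with joins-direction j
  ... | inj₁ asc  = inj₁ (rising-step asc (rising w uniq (no-vertex-below asc u∉w)))
  ... | inj₂ desc = inj₂ (falling-step desc (falling w uniq (no-vertex-above desc u∉w)))

  -- One direction gives `position u` at most `position v`, the other the reverse, so both lists are
  -- empty.
  rising-falling : ∀ {u v es es′} → Rising u v es → Falling u v es′ →
                   map edgePosition es ≡ map edgePosition es′
  rising-falling (zero , eqs , _) (zero , eqs′ , _) = trans eqs (sym eqs′)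
  rising-falling {u} {v} (k , _ , eq) (suc l , _ , eq′) = ⊥-elim (ℕₚ.<-irrefl refl
    (ℕₚ.≤-<-trans (ℕₚ.m+n≤o⇒n≤o k (ℕₚ.≤-reflexive eq))
      (subst (position v ℕ.<_) eq′ (ℕ.s≤s (ℕₚ.m≤n+m _ l)))))
  rising-falling {u} {v} (suc k , _ , eq) (l , _ , eq′) = ⊥-elim (ℕₚ.<-irrefl refl
    (ℕₚ.≤-<-trans (ℕₚ.m+n≤o⇒n≤o l (ℕₚ.≤-reflexive eq′))
      (subst (position u ℕ.<_) eq (ℕ.s≤s (ℕₚ.m≤n+m _ k)))))

  positions-unique : ∀ {u v} (p q : Path G u v) →
                     map edgePosition (pathEdges p) ≡ map edgePosition (pathEdges q)
  positions-unique {u} {v} p q with monotone p | monotone q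
  ... | inj₁ r | inj₂ f = rising-falling r f
  ... | inj₂ f | inj₁ r = sym (rising-falling r f)
  ... | inj₁ (k , eqs , eq) | inj₁ (l , eqs′ , eq′)
      with refl ← ℕₚ.+-cancelʳ-≡ (position u) k l (trans eq (sym eq′)) = trans eqs (sym eqs′)
  ... | inj₂ (k , eqs , eq) | inj₂ (l , eqs′ , eq′)
      with refl ← ℕₚ.+-cancelʳ-≡ (position v) k l (trans eq (sym eq′)) = trans eqs (sym eqs′)

  -- The route between two vertices therefore does not depend on the fees.
  pathEdges-unique : ∀ {u v} (p q : Path G u v) → pathEdges p ≡ pathEdges q
  pathEdges-unique p q = map-injective edgePosition-injective (positions-unique p q)

  -- A potential `H` on positions with edge differences `a`, in additive form because subtraction of
  -- naturals truncates.
  Increments : (ℕ → ℕ) → (Fin m → ℕ) → Set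
  Increments H a = ∀ e → a e ℕ.+ H (edgePosition e) ≡ H (suc (edgePosition e))

  telescope-rising : ∀ H {a} → Increments H a → ∀ es k {x} →
    map edgePosition es ≡ iterate suc x k → sumℕ a es ℕ.+ H x ≡ H (k ℕ.+ x)
  telescope-rising H inc []       zero    _  = refl
  telescope-rising H {a} inc (e ∷ es) (suc k) {x} eq
    with refl ← ∷-injectiveˡ eq = begin
      a e ℕ.+ sumℕ a es ℕ.+ H x    ≡⟨ cong (ℕ._+ H x) (ℕₚ.+-comm (a e) _) ⟩
      sumℕ a es ℕ.+ a e ℕ.+ H x    ≡⟨ ℕₚ.+-assoc (sumℕ a es) _ _ ⟩
      sumℕ a es ℕ.+ (a e ℕ.+ H x)  ≡⟨ cong (sumℕ a es ℕ.+_) (inc e) ⟩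
      sumℕ a es ℕ.+ H (suc x)      ≡⟨ telescope-rising H inc es k (∷-injectiveʳ eq) ⟩
      H (k ℕ.+ suc x)              ≡⟨ cong H (ℕₚ.+-suc k x) ⟩
      H (suc k ℕ.+ x)              ∎
    where open ≡-Reasoning

  telescope-falling : ∀ H {a} → Increments H a → ∀ es k {x} →
    map edgePosition es ≡ iterate pred (pred (k ℕ.+ x)) k → sumℕ a es ℕ.+ H x ≡ H (k ℕ.+ x)
  telescope-falling H inc []       zero    _  = refl
  telescope-falling H {a} inc (e ∷ es) (suc k) {x} eq = begin
      a e ℕ.+ sumℕ a es ℕ.+ H x      ≡⟨ ℕₚ.+-assoc (a e) _ _ ⟩
      a e ℕ.+ (sumℕ a es ℕ.+ H x)    ≡⟨ cong (a e ℕ.+_) (telescope-falling H inc es k (∷-injectiveʳ eq)) ⟩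
      a e ℕ.+ H (k ℕ.+ x)            ≡⟨ cong (λ y → a e ℕ.+ H y) (∷-injectiveˡ eq) ⟨
      a e ℕ.+ H (edgePosition e)     ≡⟨ inc e ⟩
      H (suc (edgePosition e))       ≡⟨ cong (H ∘ suc) (∷-injectiveˡ eq) ⟩
      H (suc k ℕ.+ x)                ∎
    where open ≡-Reasoning

  -- The interval is fixed before `H` is given, so prefix sums and their rounded levels telescope
  -- over the same two positions.
  path-interval : ∀ {u v} (p : Path G u v) → ∃[ lo ] ∃[ hi ] (hi ℕ.≤ m ×
    (∀ H {a} → Increments H a → sumℕ a (pathEdges p) ℕ.+ H lo ≡ H hi))
  path-interval {u} {v} p with monotone p
  ... | inj₁ (k , eqs , eq) = position u , position v , Finₚ.toℕ≤pred[n] _ ,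
    λ H inc → trans (telescope-rising H inc (pathEdges p) k eqs) (cong H eq)
  ... | inj₂ (k , eqs , eq) = position v , position u , Finₚ.toℕ≤pred[n] _ ,
    λ H inc → trans (telescope-falling H inc (pathEdges p) k
      (trans eqs (cong (λ x → iterate pred (pred x) k) (sym eq)))) (cong H eq)

  length-pathEdges : ∀ {u v} (p : Path G u v) → length (pathEdges p) ℕ.≤ m
  length-pathEdges p with path-interval p
  ... | lo , hi , hi≤m , tele = begin
      length (pathEdges p)                     ≡⟨ length-as-sum (pathEdges p) ⟩
      sumℕ (λ _ → 1) (pathEdges p)             ≤⟨ ℕₚ.m≤m+n _ lo ⟩
      -- The identity is a potential for the constant fee 1.
      sumℕ (λ _ → 1) (pathEdges p) ℕ.+ lo      ≡⟨ tele (λ x → x) (λ _ → refl) ⟩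
      hi                                       ≤⟨ hi≤m ⟩
      m                                        ∎
    where
    open ℕₚ.≤-Reasoning
    length-as-sum : (es : List (Fin m)) → length es ≡ sumℕ (λ _ → 1) es
    length-as-sum []       = refl
    length-as-sum (_ ∷ es) = cong suc (length-as-sum es)

  -- Indexed by position; the value past the last edge is junk.
  extend : (Fin m → ℕ) → ℕ → ℕ
  extend a k with k ℕₚ.<? m
  ... | yes k<m = a (Inverse.to edge (fromℕ< k<m))
  ... | no _    = 0

  extend-edgePosition : ∀ a e → extend a (edgePosition e) ≡ a e
  extend-edgePosition a e with edgePosition e ℕₚ.<? m
  ... | yes k<m = cong a (trans (cong (Inverse.to edge) (Finₚ.fromℕ<-toℕ _ k<m)) (to-from e))
  ... | no  k≮m = ⊥-elim (k≮m (Finₚ.toℕ<n _))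

  prefix : (Fin m → ℕ) → ℕ → ℕ
  prefix a zero    = 0
  prefix a (suc k) = extend a k ℕ.+ prefix a k

  prefix-increments : ∀ a → Increments (prefix a) a
  prefix-increments a e = cong (ℕ._+ prefix a (edgePosition e)) (sym (extend-edgePosition a e))

-- Hermite's identity and the rounding of natural fees.

∑-telescope : ∀ n (F : ℕ → ℕ) → F 0 ℕ.+ ∑ℕ.sum {n} (λ i → F (suc (toℕ i))) ≡
                                 ∑ℕ.sum {n} (λ i → F (toℕ i)) ℕ.+ F n
∑-telescope zero    F = ℕₚ.+-identityʳ (F 0)
∑-telescope (suc n) F = trans (cong (F 0 ℕ.+_) (∑-telescope n (F ∘ suc))) (sym (ℕₚ.+-assoc (F 0) _ _))

module _ (C : ℕ) .{{_ : ℕ.NonZero C}} where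

  [x+C]/C : ∀ x → (x ℕ.+ C) ℕ./ C ≡ suc (x ℕ./ C)
  [x+C]/C x = trans (DivMod.+-distrib-/-∣ʳ x ∣-refl)
    (trans (cong (x ℕ./ C ℕ.+_) (DivMod.n/n≡1 C)) (ℕₚ.+-comm _ 1))

  -- Replacing `x` by `suc x` moves the window of `C` consecutive numerators by one: the term
  -- `x / C` leaves and `(x + C) / C`, larger by one, enters.
  hermite : ∀ x → ∑ℕ.sum {C} (λ θ → (x ℕ.+ toℕ θ) ℕ./ C) ≡ x
  hermite zero = trans
    (∑ℕ.sum-cong-≋ {C} {y = λ _ → 0} (λ θ → DivMod.m<n⇒m/n≡0 (Finₚ.toℕ<n θ)))
    (∑ℕ.sum-replicate-zero C)
  hermite (suc x) = ℕₚ.+-cancelˡ-≡ (x ℕ./ C) _ _ (begin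
    x ℕ./ C ℕ.+ ∑ℕ.sum {C} (λ θ → (suc x ℕ.+ toℕ θ) ℕ./ C)
      ≡⟨ cong₂ ℕ._+_ (cong (ℕ._/ C) (sym (ℕₚ.+-identityʳ x)))
           (∑ℕ.sum-cong-≋ {C} (λ θ → cong (ℕ._/ C) (sym (ℕₚ.+-suc x (toℕ θ))))) ⟩
    (x ℕ.+ 0) ℕ./ C ℕ.+ ∑ℕ.sum {C} (λ θ → (x ℕ.+ suc (toℕ θ)) ℕ./ C)
      ≡⟨ ∑-telescope C (λ k → (x ℕ.+ k) ℕ./ C) ⟩
    ∑ℕ.sum {C} (λ θ → (x ℕ.+ toℕ θ) ℕ./ C) ℕ.+ (x ℕ.+ C) ℕ./ C
      ≡⟨ cong₂ ℕ._+_ (hermite x) ([x+C]/C x) ⟩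
    x ℕ.+ suc (x ℕ./ C)
      ≡⟨ ℕₚ.+-comm x _ ⟩
    suc (x ℕ./ C) ℕ.+ x
      ≡⟨ ℕₚ.+-suc (x ℕ./ C) x ⟨
    x ℕ./ C ℕ.+ suc x ∎)
    where open ≡-Reasoning

  quotient-jump≤1 : ∀ {g x y} → y ℕ.≤ x ℕ.+ C → g ℕ.+ x ℕ./ C ≡ y ℕ./ C → g ℕ.≤ 1
  quotient-jump≤1 {g} {x} {y} y≤x+C eq = ℕₚ.+-cancelʳ-≤ (x ℕ./ C) g 1 (begin
    g ℕ.+ x ℕ./ C     ≡⟨ eq ⟩
    y ℕ./ C           ≤⟨ DivMod./-monoˡ-≤ C y≤x+C ⟩
    (x ℕ.+ C) ℕ./ C   ≡⟨ [x+C]/C x ⟩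
    suc (x ℕ./ C)     ∎)
    where open ℕₚ.≤-Reasoning

  module Rounding (G : Graph) (isPath : IsPathGraph G) (a : Fin (Graph.m G) → ℕ) where
    open Graph G
    open PathGraph G isPath

    level : ℕ → ℕ → ℕ
    level θ k = (prefix a k ℕ.+ θ) ℕ./ C

    round : ℕ → Fin m → ℕ
    round θ e = level θ (suc (edgePosition e)) ℕ.∸ level θ (edgePosition e)

    -- Prefix sums of naturals are monotone in the position, so the truncated subtraction in `round`
    -- is exact.
    round-increments : ∀ θ → Increments (level θ) (round θ)
    round-increments θ e = ℕₚ.m∸n+n≡m (DivMod./-monoˡ-≤ C (ℕₚ.+-monoˡ-≤ θ (ℕₚ.m≤n+m _ _)))

    shift-≤ : ∀ {x y z} θ → z ℕ.+ x ≡ y → z ℕ.≤ C → y ℕ.+ θ ℕ.≤ x ℕ.+ θ ℕ.+ C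
    shift-≤ {x} {y} {z} θ eq z≤C = begin
      y ℕ.+ θ          ≡⟨ cong (ℕ._+ θ) eq ⟨
      z ℕ.+ x ℕ.+ θ    ≡⟨ ℕₚ.+-assoc z x θ ⟩
      z ℕ.+ (x ℕ.+ θ)  ≤⟨ ℕₚ.+-monoˡ-≤ (x ℕ.+ θ) z≤C ⟩
      C ℕ.+ (x ℕ.+ θ)  ≡⟨ ℕₚ.+-comm C _ ⟩
      x ℕ.+ θ ℕ.+ C    ∎
      where open ℕₚ.≤-Reasoning

    round≤1 : ∀ θ e → a e ℕ.≤ C → round θ e ℕ.≤ 1
    round≤1 θ e ae≤C = quotient-jump≤1 (shift-≤ θ (prefix-increments a e) ae≤C) (round-increments θ e)

    -- Both sums telescope over one interval: prefix sums that differ by at most `C` have levels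
    -- that differ by at most 1. This is what keeps affordable pairs affordable after rounding.
    sum-round≤1 : ∀ θ {u v} (p : Path G u v) → sumℕ a (pathEdges p) ℕ.≤ C →
                  sumℕ (round θ) (pathEdges p) ℕ.≤ 1
    sum-round≤1 θ p sum≤C with path-interval p
    ... | lo , hi , _ , tele =
      quotient-jump≤1 (shift-≤ θ (tele (prefix a) (prefix-increments a)) sum≤C)
                      (tele (level θ) (round-increments θ))

    -- Hermite's identity at both ends of the edge: the levels summed over all shifts are the prefix
    -- sums, whose difference is `a e`.
    ∑-round : ∀ e → ∑ℕ.sum {C} (λ θ → round (toℕ θ) e) ≡ a e
    ∑-round e = ℕₚ.+-cancelʳ-≡ (prefix a k) _ _ (begin
      ∑ℕ.sum {C} (λ θ → round (toℕ θ) e) ℕ.+ prefix a k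
        ≡⟨ cong (∑ℕ.sum {C} (λ θ → round (toℕ θ) e) ℕ.+_) (hermite (prefix a k)) ⟨
      ∑ℕ.sum {C} (λ θ → round (toℕ θ) e) ℕ.+ ∑ℕ.sum {C} (λ θ → level (toℕ θ) k)
        ≡⟨ ∑ℕ.∑-distrib-+ {C} (λ θ → round (toℕ θ) e) (λ θ → level (toℕ θ) k) ⟨
      ∑ℕ.sum {C} (λ θ → round (toℕ θ) e ℕ.+ level (toℕ θ) k)
        ≡⟨ ∑ℕ.sum-cong-≋ {C} (λ θ → round-increments (toℕ θ) e) ⟩
      ∑ℕ.sum {C} (λ θ → level (toℕ θ) (suc k))
        ≡⟨ hermite (prefix a (suc k)) ⟩
      prefix a (suc k)
        ≡⟨ prefix-increments a e ⟨
      a e ℕ.+ prefix a k ∎)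
      where
      open ≡-Reasoning
      k = edgePosition e

-- Totals of weighted fees over a monoid.

-- The shape of the income in the profit.  It is stated over any monoid, since
-- fees are real, rational or natural at different stages and the passages
-- between these are homomorphisms.
module _ {n m : ℕ} (w : Fin n → Fin n → ℕ) (r : Fin n → Fin n → List (Fin m)) where

  total : (M : RawMonoid 0ℓ 0ℓ) → (Fin m → RawMonoid.Carrier M) → RawMonoid.Carrier M
  total M a = M.sum λ i → M.sum λ j → listSum M (λ e → w i j M.× a e) (r i j)
    where module M = RawMonoidDefs M

module Homomorphism (M M′ : RawMonoid 0ℓ 0ℓ)
  (h : RawMonoid.Carrier M → RawMonoid.Carrier M′)
  (h-∙ : ∀ x y → h (RawMonoid._∙_ M x y) ≡ RawMonoid._∙_ M′ (h x) (h y))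
  (h-ε : h (RawMonoid.ε M) ≡ RawMonoid.ε M′) where

  open RawMonoid M using (Carrier)
  open RawMonoid M′ using () renaming (Carrier to Carrier′; _∙_ to _∙′_)

  private
    module M  = RawMonoidDefs M
    module M′ = RawMonoidDefs M′

  ×-homo : ∀ k x → h (k M.× x) ≡ k M′.× h x
  ×-homo zero    x = h-ε
  ×-homo (suc k) x = trans (h-∙ x _) (cong (h x ∙′_) (×-homo k x))

  listSum-homo : ∀ {A : Set} {a : A → Carrier} {a′ : A → Carrier′} →
                 (∀ e → h (a e) ≡ a′ e) → ∀ es → h (listSum M a es) ≡ listSum M′ a′ es
  listSum-homo eq []       = h-ε
  listSum-homo eq (e ∷ es) = trans (h-∙ _ _) (cong₂ _∙′_ (eq e) (listSum-homo eq es))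

  sum-homo : ∀ {k} {t : Fin k → Carrier} {t′ : Fin k → Carrier′} →
             (∀ i → h (t i) ≡ t′ i) → h (M.sum t) ≡ M′.sum t′
  sum-homo {zero}  eq = h-ε
  sum-homo {suc k} eq = trans (h-∙ _ _) (cong₂ _∙′_ (eq fzero) (sum-homo (eq ∘ fsuc)))

  total-homo : ∀ {n m} w r (a : Fin m → Carrier) →
               h (total {n} w r M a) ≡ total w r M′ (h ∘ a)
  total-homo w r a = sum-homo λ i → sum-homo λ j →
    listSum-homo (λ e → ×-homo (w i j) (a e)) (r i j)

module Monotone (M : RawMonoid 0ℓ 0ℓ)
  (_≼_ : RawMonoid.Carrier M → RawMonoid.Carrier M → Set)
  (ε≼ε : RawMonoid.ε M ≼ RawMonoid.ε M)
  (∙-mono : ∀ {x y u v} → x ≼ y → u ≼ v → RawMonoid._∙_ M x u ≼ RawMonoid._∙_ M y v) where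

  open RawMonoid M using (Carrier)

  private
    module M = RawMonoidDefs M

  ×-mono : ∀ k {x y} → x ≼ y → (k M.× x) ≼ (k M.× y)
  ×-mono zero    x≼y = ε≼ε
  ×-mono (suc k) x≼y = ∙-mono x≼y (×-mono k x≼y)

  listSum-mono : ∀ {A : Set} {a b : A → Carrier} →
                 (∀ e → a e ≼ b e) → ∀ es → listSum M a es ≼ listSum M b es
  listSum-mono le []       = ε≼ε
  listSum-mono le (e ∷ es) = ∙-mono (le e) (listSum-mono le es)

  sum-mono : ∀ {k} {s t : Fin k → Carrier} → (∀ i → s i ≼ t i) → M.sum s ≼ M.sum t
  sum-mono {zero}  le = ε≼ε
  sum-mono {suc k} le = ∙-mono (le fzero) (sum-mono (le ∘ fsuc))

  total-mono : ∀ {n m} w r {a b : Fin m → Carrier} → (∀ e → a e ≼ b e) →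
               total {n} w r M a ≼ total w r M b
  total-mono w r le = sum-mono λ i → sum-mono λ j →
    listSum-mono (λ e → ×-mono (w i j) (le e)) (r i j)

module Monotoneℕ = Monotone ℕ.+-0-rawMonoid ℕ._≤_ ℕ.z≤n ℕₚ.+-mono-≤
module Monotoneℚ = Monotone ℚ.+-0-rawMonoid ℚ._≤_ ℚₚ.≤-refl ℚₚ.+-mono-≤
-- With equality as the order, monotonicity becomes congruence for pointwise equal fees, which
-- stands in for function extensionality.
module Congruence (M : RawMonoid 0ℓ 0ℓ) = Monotone M _≡_ refl (cong₂ (RawMonoid._∙_ M))

pointwise : Set → RawMonoid 0ℓ 0ℓ → RawMonoid 0ℓ 0ℓ
pointwise A M = record
  { Carrier = A → Carrier
  ; _≈_     = λ f g → ∀ x → f x ≈ᴹ g x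
  ; _∙_     = λ f g x → f x ∙ g x
  ; ε       = λ _ → ε
  }
  where open RawMonoid M renaming (_≈_ to _≈ᴹ_)

-- Both summation over θ and evaluation at θ are homomorphisms from the pointwise
-- monoid of functions Fin C → ℕ, so no sums have to be interchanged by hand.
total-∑ : ∀ {n m C} w r (g : Fin C → Fin m → ℕ) →
          total {n} w r ℕ.+-0-rawMonoid (λ e → ∑ℕ.sum (λ θ → g θ e)) ≡
          ∑ℕ.sum (λ θ → total w r ℕ.+-0-rawMonoid (g θ))
total-∑ {C = C} w r g = trans
  (sym (Homomorphism.total-homo (pointwise (Fin C) ℕ.+-0-rawMonoid) ℕ.+-0-rawMonoid ∑ℕ.sum
          ∑ℕ.∑-distrib-+ (∑ℕ.sum-replicate-zero C) w r (λ e θ → g θ e)))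
  (∑ℕ.sum-cong-≋ λ θ →
     Homomorphism.total-homo (pointwise (Fin C) ℕ.+-0-rawMonoid) ℕ.+-0-rawMonoid
       (λ t → t θ) (λ _ _ → refl) refl w r (λ e θ → g θ e))

-- Bounds and maxima over finite sets.

∑-bounded : ∀ {C V} (t : Fin C → ℕ) → (∀ θ → t θ ℕ.≤ V) → ∑ℕ.sum t ℕ.≤ C ℕ.* V
∑-bounded {zero}  t t≤V = ℕ.z≤n
∑-bounded {suc C} t t≤V = ℕₚ.+-mono-≤ (t≤V fzero) (∑-bounded (t ∘ fsuc) (t≤V ∘ fsuc))

-- Candidates are vectors rather than functions, so the search can split on the first bit and reach
-- every candidate.
argmax : ∀ m (V : Vec (Fin 2) m → ℕ) → ∃[ v ] (∀ u → V u ℕ.≤ V v)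
argmax zero    V = [] , λ { [] → ℕₚ.≤-refl }
argmax (suc m) V with argmax m (V ∘ (fzero ∷_)) | argmax m (V ∘ (fsuc fzero ∷_))
... | v₀ , max₀ | v₁ , max₁ with ℕₚ.≤-total (V (fzero ∷ v₀)) (V (fsuc fzero ∷ v₁))
... | inj₁ le = _ , λ { (fzero ∷ u) → ℕₚ.≤-trans (max₀ u) le ; (fsuc fzero ∷ u) → max₁ u }
... | inj₂ ge = _ , λ { (fzero ∷ u) → max₀ u ; (fsuc fzero ∷ u) → ℕₚ.≤-trans (max₁ u) ge }

-- Naturals among the rationals and the Archimedean property.

ι : ℕ → ℚ
ι n = n ×ℚ 1ℚ

ι-homo-+ : ∀ a b → ι (a ℕ.+ b) ≡ ι a ℚ.+ ι b
ι-homo-+ = ×ℚ.×-homo-+ 1ℚ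

ι-homo-* : ∀ a b → ι (a ℕ.* b) ≡ a ×ℚ ι b
ι-homo-* a b = sym (×ℚ.×-assocˡ 1ℚ a b)

0≤1 : 0ℚ ℚ.≤ 1ℚ
0≤1 = *≤* (ℤ.+≤+ ℕ.z≤n)

0<1 : 0ℚ ℚ.< 1ℚ
0<1 = ℚ.*<* (ℤ.+<+ (ℕ.s≤s ℕ.z≤n))

ι-mono-≤ : ∀ {a b} → a ℕ.≤ b → ι a ℚ.≤ ι b
ι-mono-≤ {b = zero}  ℕ.z≤n     = ℚₚ.≤-refl
ι-mono-≤ {b = suc b} ℕ.z≤n     = ℚₚ.+-mono-≤ 0≤1 (ι-mono-≤ {b = b} ℕ.z≤n)
ι-mono-≤ (ℕ.s≤s a≤b) = ℚₚ.+-monoʳ-≤ 1ℚ (ι-mono-≤ a≤b)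

ι-mono-< : ∀ {a b} → a ℕ.< b → ι a ℚ.< ι b
ι-mono-< {a} a<b = ℚₚ.<-≤-trans
  (subst (ℚ._< ι (suc a)) (ℚₚ.+-identityˡ (ι a)) (ℚₚ.+-monoˡ-< (ι a) 0<1)) (ι-mono-≤ a<b)

ι-cancel-≤ : ∀ {a b} → ι a ℚ.≤ ι b → a ℕ.≤ b
ι-cancel-≤ {a} {b} le with a ℕₚ.≤? b
... | yes a≤b = a≤b
... | no  a≰b with () ← ℚₚ.<-irrefl refl (ℚₚ.<-≤-trans (ι-mono-< (ℕₚ.≰⇒> a≰b)) le)

×-mono-< : ∀ d {x y} → x ℚ.< y → suc d ×ℚ x ℚ.< suc d ×ℚ y
×-mono-< zero    x<y = ℚₚ.+-monoˡ-< 0ℚ x<y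
×-mono-< (suc d) x<y = ℚₚ.+-mono-< x<y (×-mono-< d x<y)

×-cancel-≤ : ∀ d {x y} → suc d ×ℚ x ℚ.≤ suc d ×ℚ y → x ℚ.≤ y
×-cancel-≤ d {x} {y} le with x ℚₚ.≤? y
... | yes x≤y = x≤y
... | no  x≰y with () ← ℚₚ.<-irrefl refl (ℚₚ.<-≤-trans (×-mono-< d (ℚₚ.≰⇒> x≰y)) le)

×-as-* : ∀ n q → n ×ℚ q ≡ ι n ℚ.* q
×-as-* n q = trans (cong (n ×ℚ_) (sym (ℚₚ.*-identityˡ q))) (sym (Mult.×-assoc-* n 1ℚ q))
  where module Mult = SemiringMult (CommutativeRing.semiring ℚₚ.+-*-commutativeRing)

×-zeroʳ : ∀ n → n ×ℚ 0ℚ ≡ 0ℚ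
×-zeroʳ n = trans (×-as-* n 0ℚ) (ℚₚ.*-zeroʳ (ι n))

ι≡mkℚ : ∀ n → ι n ≡ mkℚ (+ n) 0 (Coprimality.sym (Coprimality.1-coprimeTo n))
ι≡mkℚ zero    = refl
ι≡mkℚ (suc n) = trans (cong (1ℚ ℚ.+_) (ι≡mkℚ n))
  (trans (cong (λ k → (+ 1 ℤ.+ k) ℚ./ 1) (ℤₚ.*-identityʳ (+ n))) (ℚₚ.normalize-coprime _))

-- A nonnegative fraction is at most its numerator, since the denominator is at least 1; a negative
-- one is at most 0.
archimedean : ∀ q → ∃[ n ] (q ℚ.≤ ι n)
archimedean q@(mkℚ (+ k) d _)    = k , subst (q ℚ.≤_) (sym (ι≡mkℚ k)) (*≤*
  (subst₂ ℤ._≤_ (ℤₚ.pos-* k 1) (ℤₚ.pos-* k (suc d)) (ℤ.+≤+ (ℕₚ.*-monoʳ-≤ k (ℕ.s≤s ℕ.z≤n)))))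
archimedean q@(mkℚ -[1+ k ] d _) = 0 , ℚₚ.<⇒≤ (ℚₚ.negative⁻¹ q)

-- `d` bounds the quotient of `ι k` by `ε`; the successor only enlarges the product and is a nonzero
-- factor, which can be cancelled later.
archimedean-× : ∀ k {ε} → 0ℚ ℚ.< ε → ∃[ d ] (ι k ℚ.≤ suc d ×ℚ ε)
archimedean-× k {ε} 0<ε with archimedean (ι k ℚ.* ℚ.1/_ ε {{ℚₚ.pos⇒nonZero ε {{ℚ.positive 0<ε}}}})
... | d , le = d , (begin
    ι k                          ≡⟨ ℚₚ.*-identityʳ (ι k) ⟨
    ι k ℚ.* 1ℚ                   ≡⟨ cong (ι k ℚ.*_) (ℚₚ.*-inverseˡ ε) ⟨
    ι k ℚ.* (ℚ.1/ ε ℚ.* ε)       ≡⟨ ℚₚ.*-assoc (ι k) (ℚ.1/ ε) ε ⟨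
    ι k ℚ.* ℚ.1/ ε ℚ.* ε         ≤⟨ ℚₚ.*-monoʳ-≤-nonNeg ε (ℚₚ.≤-trans le (ι-mono-≤ (ℕₚ.n≤1+n d))) ⟩
    ι (suc d) ℚ.* ε              ≡⟨ ×-as-* (suc d) ε ⟨
    suc d ×ℚ ε                   ∎)
  where
  open ℚₚ.≤-Reasoning
  instance
    ε-positive = ℚ.positive 0<ε
    ε-nonZero  = ℚₚ.pos⇒nonZero ε
    ε-nonNeg   = ℚₚ.pos⇒nonNeg ε

unit-fraction : ∀ d → ∃[ δ ] (0ℚ ℚ.< δ × suc d ×ℚ δ ≡ 1ℚ)
unit-fraction d = ℚ.1/ ι (suc d) , ℚₚ.positive⁻¹ (ℚ.1/ ι (suc d)) {{ℚₚ.1/pos⇒pos (ι (suc d))}} ,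
  trans (×-as-* (suc d) (ℚ.1/ ι (suc d))) (ℚₚ.*-inverseʳ (ι (suc d)))
  where
  instance
    pos     = ℚ.positive (ι-mono-< {0} {suc d} (ℕ.s≤s ℕ.z≤n))
    nonZero = ℚₚ.pos⇒nonZero (ι (suc d))

-- A rational term of a nonnegative fee can be slightly negative. Down to -1 the natural 0 still
-- lies in the required range.
ceiling : ∀ q → 0ℚ ℚ.≤ 1ℚ ℚ.+ q → ∃[ a ] (q ℚ.≤ ι a × ι a ℚ.≤ 1ℚ ℚ.+ q)
ceiling q -1≤q with archimedean q
... | n , q≤n = descend n q≤n
  where
  descend : ∀ n → q ℚ.≤ ι n → ∃[ a ] (q ℚ.≤ ι a × ι a ℚ.≤ 1ℚ ℚ.+ q)
  descend zero    q≤0 = 0 , q≤0 , -1≤q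
  descend (suc n) q≤1+n with q ℚₚ.≤? ι n
  ... | yes q≤n = descend n q≤n
  -- The predecessor `n` is already below `q`, so `suc n` exceeds `q` by at most 1.
  ... | no  q≰n = suc n , q≤1+n , ℚₚ.+-monoʳ-≤ 1ℚ (ℚₚ.<⇒≤ (ℚₚ.≰⇒> q≰n))

-- Eventual properties of sequences and termwise evaluation.

Eventually : (ℕ → Set) → Set
Eventually P = ∃[ N ] (∀ i → N ℕ.≤ i → P i)

eventually-× : {P Q : ℕ → Set} → Eventually P → Eventually Q → Eventually (λ i → P i × Q i)
eventually-× (N , p) (N′ , q) = N ℕ.⊔ N′ , λ i le →
  p i (ℕₚ.m⊔n≤o⇒m≤o N N′ le) , q i (ℕₚ.m⊔n≤o⇒n≤o N N′ le)

eventually-∀ : ∀ {k} {P : Fin k → ℕ → Set} → (∀ x → Eventually (P x)) →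
               Eventually (λ i → ∀ x → P x i)
eventually-∀ {zero}  ev = 0 , λ _ _ ()
eventually-∀ {suc k} ev with eventually-× (ev fzero) (eventually-∀ (ev ∘ fsuc))
... | N , p = N , λ
  { i le fzero    → proj₁ (p i le)
  ; i le (fsuc x) → proj₂ (p i le) x }

-- Addition of reals is termwise, so taking a term of the sequence is a homomorphism with
-- definitional laws.
module SeqHomo (N : ℕ) = Homomorphism +-0-rawMonoid ℚ.+-0-rawMonoid (λ x → seq x N) (λ _ _ → refl) refl
module ιHomo = Homomorphism ℕ.+-0-rawMonoid ℚ.+-0-rawMonoid ι ι-homo-+ refl
module ScaleHomo (d : ℕ) = Homomorphism ℚ.+-0-rawMonoid ℚ.+-0-rawMonoid (d ×ℚ_)
  (λ x y → ×ℚ.×-distrib-+ x y d) (×-zeroʳ d)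

≤-termwise : ∀ {x y : ℝ} → (∀ i → seq x i ℚ.≤ seq y i) → x ≤ y
≤-termwise {x} {y} le ε 0<ε = 0 , λ i _ → ℚₚ.≤-trans (le i)
  (ℚₚ.≤-trans (ℚₚ.≤-reflexive (sym (ℚₚ.+-identityʳ (seq y i)))) (ℚₚ.+-monoʳ-≤ (seq y i) (ℚₚ.<⇒≤ 0<ε)))

≈-refl : ∀ {x : ℝ} → x ≈ x
≈-refl {x} = ≤-termwise {x} {x} (λ _ → ℚₚ.≤-refl) , ≤-termwise {x} {x} (λ _ → ℚₚ.≤-refl)

-- Zero-one fee assignments.

bit : ∀ {m} → Vec (Fin 2) m → Fin m → ℕ
bit v e = toℕ (Vec.lookup v e)

module _ {G : Graph} where
  open Graph G

  zeroOne : Vec (Fin 2) m → FeeAssignment G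
  zeroOne v = record
    { fee   = λ e → fromℚ (ι (bit v e))
    ; 0≤fee = λ e → ≤-termwise {0ℝ} {fromℚ (ι (bit v e))} λ _ → ι-mono-≤ {0} {bit v e} ℕ.z≤n
    ; fee≤1 = λ e → ≤-termwise {fromℚ (ι (bit v e))} {1ℝ} λ _ →
        ι-mono-≤ {b = 1} (ℕ.s≤s⁻¹ (Finₚ.toℕ<n (Vec.lookup v e)))
    }

  zeroOne-isZeroOne : ∀ v → IsZeroOne (zeroOne v)
  zeroOne-isZeroOne v e with Vec.lookup v e
  ... | fzero      = inj₁ (≈-refl {0ℝ})
  ... | fsuc fzero = inj₂ (≈-refl {1ℝ})

  cost-zeroOne : ∀ v {i j} (p : Path G i j) N →
                 seq (cost (zeroOne v) p) N ≡ ι (sumℕ (bit v) (pathEdges p))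
  cost-zeroOne v p N = trans (SeqHomo.listSum-homo N (λ _ → refl) (pathEdges p))
                             (sym (ιHomo.listSum-homo (λ _ → refl) (pathEdges p)))

-- The profit in terms of weights and routes.

module Profit (em : ExcludedMiddle 0ℓ) (G : Graph) (isPath : IsPathGraph G)
              (𝐓 : TransactionMatrix (Graph.n G)) where
  open Graph G
  open TransactionMatrix 𝐓
  open PathGraph G isPath
  open FeeAssignment

  -- The decision is an argument so that proofs can split on it; with `em` supplied, the weights and
  -- routes describe `income`.
  weight : (f : FeeAssignment G) (i j : Fin n) → Dec (CheapestPath f i j) → ℕ
  weight f i j (yes (p , _)) = X em G 𝐓 f p ℕ.* T i j
  weight f i j (no _)        = 0

  route : (f : FeeAssignment G) (i j : Fin n) → Dec (CheapestPath f i j) → List (Fin m)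
  route f i j (yes (p , _)) = pathEdges p
  route f i j (no _)        = []

  weights : FeeAssignment G → Fin n → Fin n → ℕ
  weights f i j = weight f i j em

  routes : FeeAssignment G → Fin n → Fin n → List (Fin m)
  routes f i j = route f i j em

  routed : (M : RawMonoid 0ℓ 0ℓ) → FeeAssignment G → (Fin m → RawMonoid.Carrier M) → RawMonoid.Carrier M
  routed M f = total (weights f) (routes f) M

  base : ℚ
  base = (ℤ.- (+ m)) ℚ./ 1

  seq-profit : ∀ f N → seq (profit em G 𝐓 f) N ≡
               base ℚ.+ routed ℚ.+-0-rawMonoid f (λ e → seq (fee f e) N)
  seq-profit f N = cong (base ℚ.+_) (SeqHomo.sum-homo N λ i → SeqHomo.sum-homo N λ j → seq-income i j em)
    where
    seq-income : ∀ i j (d : Dec (CheapestPath f i j)) → seq (income em G 𝐓 f i j d) N ≡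
      listSum ℚ.+-0-rawMonoid (λ e → weight f i j d ×ℚ seq (fee f e) N) (route f i j d)
    seq-income i j (no _)        = refl
    seq-income i j (yes (p , _)) = SeqHomo.listSum-homo N
      (λ e → SeqHomo.×-homo N (X em G 𝐓 f p ℕ.* T i j) (fee f e)) (pathEdges p)

  -- Zero-one fees give a natural income, so an optimal assignment among them is found by comparing
  -- naturals.
  revenue : Vec (Fin 2) m → ℕ
  revenue v = routed ℕ.+-0-rawMonoid (zeroOne v) (bit v)

  seq-profit-zeroOne : ∀ v N → seq (profit em G 𝐓 (zeroOne v)) N ≡ base ℚ.+ ι (revenue v)
  seq-profit-zeroOne v N = trans (seq-profit (zeroOne v) N)
    (cong (base ℚ.+_) (sym (ιHomo.total-homo (weights (zeroOne v)) (routes (zeroOne v)) (bit v))))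

  -- Weights and routes stay those of `f` while `a` supplies the fees. A pair of weight 0 earns
  -- nothing and is left unconstrained.
  Affordable : FeeAssignment G → (Fin m → ℕ) → ℕ → Set
  Affordable f a C = ∀ i j → weight f i j em ≡ 0 ⊎ sumℕ a (route f i j em) ℕ.≤ C

  listSum-zero : ∀ {A : Set} {a : A → ℕ} → (∀ e → a e ≡ 0) → ∀ es → sumℕ a es ≡ 0
  listSum-zero a≡0 []       = refl
  listSum-zero a≡0 (e ∷ es) = cong₂ ℕ._+_ (a≡0 e) (listSum-zero a≡0 es)

  indicator : {A : Set} → Dec A → ℕ
  indicator d = if does d then 1 else 0

  X≤1 : (f : FeeAssignment G) {i j : Fin n} (p : Path G i j) → X em G 𝐓 f p ℕ.≤ 1
  X≤1 f p = indicator≤1 em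
    where
    indicator≤1 : (d : Dec (cost f p ≤ 1ℝ)) → indicator d ℕ.≤ 1
    indicator≤1 (yes _) = ℕₚ.≤-refl
    indicator≤1 (no _)  = ℕ.z≤n

  X≡1 : (f : FeeAssignment G) {i j : Fin n} (p : Path G i j) → cost f p ≤ 1ℝ → X em G 𝐓 f p ≡ 1
  X≡1 f p c≤1 = indicator≡1 em
    where
    indicator≡1 : (d : Dec (cost f p ≤ 1ℝ)) → indicator d ≡ 1
    indicator≡1 (yes _)  = refl
    indicator≡1 (no c≰1) = ⊥-elim (c≰1 c≤1)

  X≡0⊎cost≤1 : (f : FeeAssignment G) {i j : Fin n} (p : Path G i j) → X em G 𝐓 f p ≡ 0 ⊎ cost f p ≤ 1ℝ
  X≡0⊎cost≤1 f p = indicator≡0⊎cost≤1 em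
    where
    indicator≡0⊎cost≤1 : (d : Dec (cost f p ≤ 1ℝ)) → indicator d ≡ 0 ⊎ cost f p ≤ 1ℝ
    indicator≡0⊎cost≤1 (yes c≤1) = inj₂ c≤1
    indicator≡0⊎cost≤1 (no _)    = inj₁ refl

  -- All paths between two vertices of a path graph have the same edges, hence equal cost, so any of
  -- them is cheapest under any fees.
  cheapest-transfer : ∀ f f′ {i j} → CheapestPath f i j → CheapestPath f′ i j
  cheapest-transfer f f′ (p , _) = p , λ q →
    subst (λ es → cost f′ p ≤ sumList (map (fee f′) es)) (pathEdges-unique p q)
      (proj₁ (≈-refl {cost f′ p}))

  -- Every pair of nonzero weight under `f` pays at most 1 under `v` as well and is served again.
  -- Pairs newly served only add revenue.
  routed-≤-revenue : ∀ f v → Affordable f (bit v) 1 →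
                     routed ℕ.+-0-rawMonoid f (bit v) ℕ.≤ revenue v
  routed-≤-revenue f v afford = Monotoneℕ.sum-mono λ i → Monotoneℕ.sum-mono λ j → compare i j em em (afford i j)
    where
    compare : ∀ i j (d : Dec (CheapestPath f i j)) (d′ : Dec (CheapestPath (zeroOne v) i j)) →
      weight f i j d ≡ 0 ⊎ sumℕ (bit v) (route f i j d) ℕ.≤ 1 →
      sumℕ (λ e → weight f i j d ×ℕ bit v e) (route f i j d) ℕ.≤
      sumℕ (λ e → weight (zeroOne v) i j d′ ×ℕ bit v e) (route (zeroOne v) i j d′)
    compare i j d d′ (inj₁ w≡0) = ℕₚ.≤-trans
      (ℕₚ.≤-reflexive (listSum-zero (λ e → cong (_×ℕ bit v e) w≡0) (route f i j d))) ℕ.z≤n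
    compare i j (no _) _ (inj₂ _) = ℕ.z≤n
    compare i j (yes c) (no ¬c) (inj₂ _) = ⊥-elim (¬c (cheapest-transfer f (zeroOne v) c))
    compare i j (yes (p , _)) (yes (q , _)) (inj₂ sum≤1) = ℕₚ.≤-trans
      (ℕₚ.≤-reflexive (cong (sumℕ _) (pathEdges-unique p q)))
      (Monotoneℕ.listSum-mono (λ e → ×-monoˡ (bit v e) weight-≤) (pathEdges q))
      where
      ×-monoˡ : ∀ {k l} x → k ℕ.≤ l → k ×ℕ x ℕ.≤ l ×ℕ x
      ×-monoˡ x ℕ.z≤n     = ℕ.z≤n
      ×-monoˡ x (ℕ.s≤s k≤l) = ℕₚ.+-monoʳ-≤ x (×-monoˡ x k≤l)

      q-open : X em G 𝐓 (zeroOne v) q ≡ 1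
      q-open = X≡1 (zeroOne v) q (≤-termwise {cost (zeroOne v) q} {1ℝ} λ N →
        subst (ℚ._≤ 1ℚ) (sym (cost-zeroOne v q N)) (ι-mono-≤ {sumℕ (bit v) (pathEdges q)} {1}
          (subst (λ es → sumℕ (bit v) es ℕ.≤ 1) (pathEdges-unique p q) sum≤1)))

      weight-≤ : X em G 𝐓 f p ℕ.* T i j ℕ.≤ X em G 𝐓 (zeroOne v) q ℕ.* T i j
      weight-≤ = ℕₚ.*-monoˡ-≤ (T i j) (subst (X em G 𝐓 f p ℕ.≤_) (sym q-open) (X≤1 f p))

  -- With the weights of `f` held fixed the total is linear in the fees, so it is the sum over `C`
  -- shifts of totals of rounded fees, each at most `V`.
  rounding-bound : ∀ f a C .{{_ : ℕ.NonZero C}} V → (∀ v → revenue v ℕ.≤ V) →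
    (∀ e → a e ℕ.≤ C) → Affordable f a C → routed ℕ.+-0-rawMonoid f a ℕ.≤ C ℕ.* V
  rounding-bound f a C V rev≤V a≤C afford = begin
    routed ℕ.+-0-rawMonoid f a
      ≡⟨ Congruence.total-mono ℕ.+-0-rawMonoid (weights f) (routes f) (λ e → sym (∑-round e)) ⟩
    routed ℕ.+-0-rawMonoid f (λ e → ∑ℕ.sum {C} (λ θ → round (toℕ θ) e))
      ≡⟨ total-∑ {C = C} (weights f) (routes f) (round ∘ toℕ) ⟩
    ∑ℕ.sum {C} (λ θ → routed ℕ.+-0-rawMonoid f (round (toℕ θ)))
      ≤⟨ ∑-bounded {C} _ (λ θ → each (toℕ θ)) ⟩
    C ℕ.* V ∎
    where
    open ℕₚ.≤-Reasoning
    open Rounding C G isPath a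

    bits : ℕ → Vec (Fin 2) m
    bits θ = Vec.tabulate λ e → fromℕ< (ℕ.s≤s (round≤1 θ e (a≤C e)))

    bit-bits : ∀ θ e → bit (bits θ) e ≡ round θ e
    bit-bits θ e = trans (cong toℕ (lookup∘tabulate _ e)) (Finₚ.toℕ-fromℕ< _)

    affordable-bits : ∀ θ → Affordable f (bit (bits θ)) 1
    affordable-bits θ i j = go em (afford i j)
      where
      go : (d : Dec (CheapestPath f i j)) → weight f i j d ≡ 0 ⊎ sumℕ a (route f i j d) ℕ.≤ C →
           weight f i j d ≡ 0 ⊎ sumℕ (bit (bits θ)) (route f i j d) ℕ.≤ 1
      go d             (inj₁ w≡0)   = inj₁ w≡0
      go (no _)        (inj₂ _)     = inj₁ refl
      go (yes (p , _)) (inj₂ sum≤C) = inj₂ (subst (ℕ._≤ 1)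
        (Congruence.listSum-mono ℕ.+-0-rawMonoid (λ e → sym (bit-bits θ e)) (pathEdges p))
        (sum-round≤1 θ p sum≤C))

    each : ∀ θ → routed ℕ.+-0-rawMonoid f (round θ) ℕ.≤ V
    each θ = begin
      routed ℕ.+-0-rawMonoid f (round θ)
        ≡⟨ Congruence.total-mono ℕ.+-0-rawMonoid (weights f) (routes f) (bit-bits θ) ⟨
      routed ℕ.+-0-rawMonoid f (bit (bits θ))
        ≤⟨ routed-≤-revenue f (bits θ) (affordable-bits θ) ⟩
      revenue (bits θ)
        ≤⟨ rev≤V (bits θ) ⟩
      V ∎

  -- Approximation of real fees by naturals.

  AlmostFeasible : FeeAssignment G → ℚ → (Fin m → ℚ) → Set
  AlmostFeasible f δ φ = (∀ e → 0ℚ ℚ.≤ φ e ℚ.+ δ) × (∀ e → φ e ℚ.≤ 1ℚ ℚ.+ δ) ×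
    (∀ i j → weight f i j em ≡ 0 ⊎ listSum ℚ.+-0-rawMonoid φ (route f i j em) ℚ.≤ 1ℚ ℚ.+ δ)

  -- Inequalities of reals hold termwise up to `δ` from some index on, and only finitely many are
  -- involved.
  eventually-feasible : ∀ f {δ} → 0ℚ ℚ.< δ →
    Eventually (λ N → AlmostFeasible f δ (λ e → seq (fee f e) N))
  eventually-feasible f {δ} 0<δ =
    eventually-× (eventually-∀ (λ e → 0≤fee f e δ 0<δ))
      (eventually-× (eventually-∀ (λ e → fee≤1 f e δ 0<δ))
        (eventually-∀ (λ i → eventually-∀ (λ j → pair i j em))))
    where
    pair : ∀ i j (d : Dec (CheapestPath f i j)) → Eventually λ N → weight f i j d ≡ 0 ⊎
           listSum ℚ.+-0-rawMonoid (λ e → seq (fee f e) N) (route f i j d) ℚ.≤ 1ℚ ℚ.+ δ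
    pair i j (no _) = 0 , λ _ _ → inj₁ refl
    pair i j (yes (p , _)) = bounded (X≡0⊎cost≤1 f p)
      where
      bounded : X em G 𝐓 f p ≡ 0 ⊎ cost f p ≤ 1ℝ → Eventually λ N → X em G 𝐓 f p ℕ.* T i j ≡ 0 ⊎
                listSum ℚ.+-0-rawMonoid (λ e → seq (fee f e) N) (pathEdges p) ℚ.≤ 1ℚ ℚ.+ δ
      bounded (inj₁ X≡0) = 0 , λ _ _ → inj₁ (cong (ℕ._* T i j) X≡0)
      bounded (inj₂ c≤1) = proj₁ (c≤1 δ 0<δ) , λ k N≤k → inj₂
        (subst (ℚ._≤ 1ℚ ℚ.+ δ) (SeqHomo.listSum-homo k (λ _ → refl) (pathEdges p)) (proj₂ (c≤1 δ 0<δ) k N≤k))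

  module _ (f : FeeAssignment G) (d : ℕ) {δ : ℚ} (D×δ≡1 : suc d ×ℚ δ ≡ 1ℚ)
           {φ : Fin m → ℚ} (feasible : AlmostFeasible f δ φ) where

    private
      D = suc d
      -- D(1+δ) = D + 1, plus a rounding error of at most 1 per edge of a path.
      -- The further 1 lets a single edge satisfy the bound even without m ≥ 1.
      C = D ℕ.+ (2 ℕ.+ m)

    D×1+δ : D ×ℚ (1ℚ ℚ.+ δ) ≡ ι (D ℕ.+ 1)
    D×1+δ = trans (×ℚ.×-distrib-+ 1ℚ δ D) (trans (cong (ι D ℚ.+_) D×δ≡1) (sym (ι-homo-+ D 1)))

    approximation : ∀ e → ∃[ a ] (D ×ℚ φ e ℚ.≤ ι a × ι a ℚ.≤ 1ℚ ℚ.+ D ×ℚ φ e)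
    approximation e = ceiling (D ×ℚ φ e) (begin
      0ℚ                       ≡⟨ ×-zeroʳ D ⟨
      D ×ℚ 0ℚ                  ≤⟨ Monotoneℚ.×-mono D (proj₁ feasible e) ⟩
      D ×ℚ (φ e ℚ.+ δ)         ≡⟨ ×ℚ.×-distrib-+ (φ e) δ D ⟩
      D ×ℚ φ e ℚ.+ D ×ℚ δ      ≡⟨ cong (D ×ℚ φ e ℚ.+_) D×δ≡1 ⟩
      D ×ℚ φ e ℚ.+ 1ℚ          ≡⟨ ℚₚ.+-comm (D ×ℚ φ e) 1ℚ ⟩
      1ℚ ℚ.+ D ×ℚ φ e          ∎)
      where open ℚₚ.≤-Reasoning

    scaled : Fin m → ℕ
    scaled e = proj₁ (approximation e)

    -- `s` counts the ceilings taken, each with error at most 1: one for a single edge, the length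
    -- for a path.
    scaled-≤ : ∀ {x k s} → s ℕ.≤ m ℕ.+ 1 → x ℚ.≤ 1ℚ ℚ.+ δ → ι k ℚ.≤ ι s ℚ.+ D ×ℚ x → k ℕ.≤ C
    scaled-≤ {x} {k} {s} s≤m+1 x≤1+δ le = ι-cancel-≤ (begin
      ι k                          ≤⟨ le ⟩
      ι s ℚ.+ D ×ℚ x               ≤⟨ ℚₚ.+-mono-≤ (ι-mono-≤ s≤m+1) (Monotoneℚ.×-mono D x≤1+δ) ⟩
      ι (m ℕ.+ 1) ℚ.+ D ×ℚ (1ℚ ℚ.+ δ) ≡⟨ cong (ι (m ℕ.+ 1) ℚ.+_) D×1+δ ⟩
      ι (m ℕ.+ 1) ℚ.+ ι (D ℕ.+ 1)  ≡⟨ ι-homo-+ (m ℕ.+ 1) (D ℕ.+ 1) ⟨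
      ι (m ℕ.+ 1 ℕ.+ (D ℕ.+ 1))    ≡⟨ cong ι (rearrange m D) ⟩
      ι C                          ∎)
      where
      open ℚₚ.≤-Reasoning
      open +-*-Solver
      rearrange : ∀ m D → m ℕ.+ 1 ℕ.+ (D ℕ.+ 1) ≡ D ℕ.+ (2 ℕ.+ m)
      rearrange = solve 2 (λ m D → m :+ con 1 :+ (D :+ con 1) := D :+ (con 2 :+ m)) refl

    scaled≤C : ∀ e → scaled e ℕ.≤ C
    scaled≤C e = scaled-≤ {s = 1} (ℕₚ.m≤n+m 1 m) (proj₁ (proj₂ feasible) e)
      (proj₂ (proj₂ (approximation e)))

    listSum-scaled : ∀ es → ι (sumℕ scaled es) ℚ.≤ ι (length es) ℚ.+ D ×ℚ listSum ℚ.+-0-rawMonoid φ es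
    listSum-scaled []       = ℚₚ.≤-reflexive (sym (trans (ℚₚ.+-identityˡ _) (×-zeroʳ D)))
    listSum-scaled (e ∷ es) = begin
      ι (scaled e ℕ.+ sumℕ scaled es)
        ≡⟨ ι-homo-+ (scaled e) _ ⟩
      ι (scaled e) ℚ.+ ι (sumℕ scaled es)
        ≤⟨ ℚₚ.+-mono-≤ (proj₂ (proj₂ (approximation e))) (listSum-scaled es) ⟩
      (1ℚ ℚ.+ D ×ℚ φ e) ℚ.+ (ι (length es) ℚ.+ D ×ℚ s)
        ≡⟨ interchange 1ℚ (D ×ℚ φ e) (ι (length es)) (D ×ℚ s) ⟩
      (1ℚ ℚ.+ ι (length es)) ℚ.+ (D ×ℚ φ e ℚ.+ D ×ℚ s)
        ≡⟨ cong (ι (suc (length es)) ℚ.+_) (×ℚ.×-distrib-+ (φ e) s D) ⟨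
      ι (suc (length es)) ℚ.+ D ×ℚ (φ e ℚ.+ s) ∎
      where
      open ℚₚ.≤-Reasoning
      open CommutativeSemigroupProperties
        (CommutativeMonoid.commutativeSemigroup ℚₚ.+-0-commutativeMonoid) using (interchange)
      s = listSum ℚ.+-0-rawMonoid φ es

    scaled-affordable : Affordable f scaled C
    scaled-affordable i j = go em (proj₂ (proj₂ feasible) i j)
      where
      go : (c : Dec (CheapestPath f i j)) →
           weight f i j c ≡ 0 ⊎ listSum ℚ.+-0-rawMonoid φ (route f i j c) ℚ.≤ 1ℚ ℚ.+ δ →
           weight f i j c ≡ 0 ⊎ sumℕ scaled (route f i j c) ℕ.≤ C
      go c             (inj₁ w≡0) = inj₁ w≡0
      go (no _)        (inj₂ _)   = inj₁ refl
      go (yes (p , _)) (inj₂ le)  = inj₂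
        (scaled-≤ (ℕₚ.≤-trans (length-pathEdges p) (ℕₚ.m≤m+n m 1)) le (listSum-scaled (pathEdges p)))

    -- Ceilings only raise the fees, so the scaled income is at most that of `scaled`, to which the
    -- averaging bound applies.
    routed-bound : ∀ V → (∀ v → revenue v ℕ.≤ V) →
                   D ×ℚ routed ℚ.+-0-rawMonoid f φ ℚ.≤ ι (C ℕ.* V)
    routed-bound V rev≤V = begin
      D ×ℚ routed ℚ.+-0-rawMonoid f φ
        ≡⟨ ScaleHomo.total-homo D (weights f) (routes f) φ ⟩
      routed ℚ.+-0-rawMonoid f (λ e → D ×ℚ φ e)
        ≤⟨ Monotoneℚ.total-mono (weights f) (routes f) (λ e → proj₁ (proj₂ (approximation e))) ⟩
      routed ℚ.+-0-rawMonoid f (ι ∘ scaled)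
        ≡⟨ ιHomo.total-homo (weights f) (routes f) scaled ⟨
      ι (routed ℕ.+-0-rawMonoid f scaled)
        ≤⟨ ι-mono-≤ (rounding-bound f scaled C V rev≤V scaled≤C scaled-affordable) ⟩
      ι (C ℕ.* V) ∎
      where open ℚₚ.≤-Reasoning

  -- Optimality as the scale grows.

  profit-≤ : ∀ v → (∀ u → revenue u ℕ.≤ revenue v) →
             ∀ f → profit em G 𝐓 f ≤ profit em G 𝐓 (zeroOne v)
  profit-≤ v max f ε 0<ε = N , λ k N≤k → begin
    seq (profit em G 𝐓 f) k
      ≡⟨ seq-profit f k ⟩
    base ℚ.+ routed ℚ.+-0-rawMonoid f (λ e → seq (fee f e) k)
      ≤⟨ ℚₚ.+-monoʳ-≤ base (×-cancel-≤ d (ℚₚ.≤-trans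
           (routed-bound f d D×δ≡1 (feasible k N≤k) V max) C×V≤)) ⟩
    base ℚ.+ (ι V ℚ.+ ε)
      ≡⟨ ℚₚ.+-assoc base (ι V) ε ⟨
    base ℚ.+ ι V ℚ.+ ε
      ≡⟨ cong (ℚ._+ ε) (seq-profit-zeroOne v k) ⟨
    seq (profit em G 𝐓 (zeroOne v)) k ℚ.+ ε ∎
    where
    open ℚₚ.≤-Reasoning
    V = revenue v
    -- The excess of `C` over `D` is `2 + m`; `d` is taken so large that this excess times `V` is at
    -- most `D` times `ε`.
    scale = archimedean-× ((2 ℕ.+ m) ℕ.* V) 0<ε
    d = proj₁ scale
    D = suc d
    K≤D×ε = proj₂ scale
    -- The tolerance `δ` is `1 / D`, so each constraint is off by at most 1 after scaling by `D`.
    fraction = unit-fraction d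
    D×δ≡1 = proj₂ (proj₂ fraction)
    eventual = eventually-feasible f (proj₁ (proj₂ fraction))
    N = proj₁ eventual
    feasible = proj₂ eventual
    C×V≤ : ι ((D ℕ.+ (2 ℕ.+ m)) ℕ.* V) ℚ.≤ D ×ℚ (ι V ℚ.+ ε)
    C×V≤ = begin
      ι ((D ℕ.+ (2 ℕ.+ m)) ℕ.* V)              ≡⟨ cong ι (ℕₚ.*-distribʳ-+ V D (2 ℕ.+ m)) ⟩
      ι (D ℕ.* V ℕ.+ (2 ℕ.+ m) ℕ.* V)          ≡⟨ ι-homo-+ (D ℕ.* V) _ ⟩
      ι (D ℕ.* V) ℚ.+ ι ((2 ℕ.+ m) ℕ.* V)      ≤⟨ ℚₚ.+-mono-≤ (ℚₚ.≤-reflexive (ι-homo-* D V)) K≤D×ε ⟩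
      D ×ℚ ι V ℚ.+ D ×ℚ ε                      ≡⟨ ×ℚ.×-distrib-+ (ι V) ε D ⟨
      D ×ℚ (ι V ℚ.+ ε)                         ∎

lemma1 : (em : ExcludedMiddle 0ℓ) (G : Graph) → IsPathGraph G →
    (T : TransactionMatrix (Graph.n G)) →
    Σ[ f ∈ FeeAssignment G ] (IsZeroOne f ×
    ((f′ : FeeAssignment G) → profit em G T f′ ≤ profit em G T f))
lemma1 em G isPath T = zeroOne best , zeroOne-isZeroOne {G} best , profit-≤ best (proj₂ optimum)
  where
  open Profit em G isPath T
  optimum = argmax (Graph.m G) revenue
  best    = proj₁ optimum
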